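{- Let $G$ be a finite simple graph with minimum degree $\delta=\delta(G)\ge 2$ and maximum degree $\Delta=\Delta(G)$. Then $$\chi_2(G)-\chi(G)\le \left\lceil \sqrt[\delta-1]{4\Delta^2}\right\rceil\left(\left\lfloor \log_{\frac{2\Delta(G)}{2\Delta(G)-\delta(G)}} \alpha(G)\right\rfloor+1\right)+1.$$
   Context: $\chi(G)$ is the chromatic number and $\alpha(G)$ the independence number of $G$. A dynamic coloring of $G$ is a proper vertex coloring such that for every vertex $v$ of degree at least $2$, the neighbours of $v$ receive at least two different colors; $\chi_2(G)$, the dynamic chromatic number, is the smallest number of colors in a dynamic coloring of $G$. The paper writes $\log_b \alpha(G)$ as $\log^{\alpha(G)}_{b}$. -}

module Defs where

open import Data.Nat using (ℕ; zero; suc; _+_; _*_; _∸_; _^_; _≤_; _<_)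
open import Data.Bool using (Bool; true; false; if_then_else_)
open import Data.Fin using (Fin)
open import Data.Fin.Subset using (Subset; _∈_; ∣_∣)
open import Data.List using (List; map; allFin)
open import Data.Nat.ListAction using (sum)
open import Data.Product using (Σ; _×_; ∃; ∃-syntax)
open import Relation.Binary.PropositionalEquality using (_≡_; _≢_)

record Graph : Set where
  field
    n     : ℕ
    Adj   : Fin n → Fin n → Bool
    sym   : ∀ u v → Adj u v ≡ Adj v u
    irrefl : ∀ v → Adj v v ≡ false
open Graph public

deg : (G : Graph) → Fin (n G) → ℕ
deg G v = sum (map (λ u → if Adj G v u then 1 else 0) (allFin (n G)))

IsMinDegree : Graph → ℕ → Set
IsMinDegree G δ = (∀ v → δ ≤ deg G v) × ∃[ v ] deg G v ≡ δ

IsMaxDegree : Graph → ℕ → Set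
IsMaxDegree G Δ = (∀ v → deg G v ≤ Δ) × ∃[ v ] deg G v ≡ Δ

IsProper : (G : Graph) {k : ℕ} → (Fin (n G) → Fin k) → Set
IsProper G c = ∀ u v → Adj G u v ≡ true → c u ≢ c v

IsDynamic : (G : Graph) {k : ℕ} → (Fin (n G) → Fin k) → Set
IsDynamic G c = IsProper G c ×
  (∀ v → 2 ≤ deg G v →
     ∃[ u ] ∃[ w ] (Adj G v u ≡ true × Adj G v w ≡ true × c u ≢ c w))

Colorable : Graph → ℕ → Set
Colorable G k = Σ (Fin (n G) → Fin k) (IsProper G)

DynColorable : Graph → ℕ → Set
DynColorable G k = Σ (Fin (n G) → Fin k) (IsDynamic G)

IsChromaticNumber : Graph → ℕ → Set
IsChromaticNumber G k = Colorable G k × (∀ j → Colorable G j → k ≤ j)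

IsDynChromaticNumber : Graph → ℕ → Set
IsDynChromaticNumber G k = DynColorable G k × (∀ j → DynColorable G j → k ≤ j)

IsIndependent : (G : Graph) → Subset (n G) → Set
IsIndependent G S = ∀ u v → u ∈ S → v ∈ S → Adj G u v ≡ false

IsIndependenceNumber : Graph → ℕ → Set
IsIndependenceNumber G a =
  (∃[ S ] (IsIndependent G S × ∣ S ∣ ≡ a)) ×
  (∀ S → IsIndependent G S → ∣ S ∣ ≤ a)

-- k = ⌈ (M)^(1/e) ⌉ for M ≥ 1, e ≥ 1: least k with k^e ≥ M
IsCeilRoot : (e M k : ℕ) → Set
IsCeilRoot e M k = (M ≤ k ^ e) × ((k ∸ 1) ^ e < M)

-- L = ⌊ log_{p/q} a ⌋ (p > q ≥ 1, a ≥ 1): (p/q)^L ≤ a < (p/q)^(L+1)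
IsFloorLog : (p q a L : ℕ) → Set
IsFloorLog p q a L = (p ^ L ≤ a * q ^ L) × (a * q ^ suc L < p ^ suc L)

{-# OPTIONS --safe #-}
module Submission where

-- A vertex is bad for a proper colouring c if its neighbourhood is monochromatic. A bad
-- vertex is a strict local minimum or maximum of c, so a χ-colouring has at most 2α bad
-- vertices. Fix f : V → k for which no neighbourhood is monochromatic. Giving an
-- independent set I the colours f, in k fresh copies, keeps the colouring proper, makes
-- every vertex with a neighbour in I good and spoils no other. A greedy choice of I hits
-- at least the fraction δ/(2Δ) of the bad neighbourhoods. After L + 1 such rounds fewer
-- than 2 bad vertices are left, and recolouring a single neighbour of the last one with
-- one more colour repairs it. The map f comes from Rosenfeld's counting argument, which
-- here replaces the Lovász local lemma: adding a vertex to S keeps at least the fraction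
-- (δ-1)/δ of the k-colourings in which no edge inside S is monochromatic.

open import Defs renaming (sym to Adj-sym; n to order)
open import Data.Bool using (Bool; true; false; if_then_else_)
open import Data.Bool.Properties using () renaming (_≟_ to _≟ᵇ_)
open import Data.Nat hiding (_≟_)
open import Data.Nat.Properties hiding (_≟_)
open import Data.Nat.Tactic.RingSolver using (solve-∀)
import Data.Nat.ListAction as ListAction
open import Data.Fin as Fin using (Fin; zero; suc; _↑ˡ_; _↑ʳ_; splitAt)
open import Data.Fin.Properties as Fin
  using (_≟_; any?; all?; ¬∀⟶∃¬; splitAt-↑ˡ; splitAt-↑ʳ; ↑ˡ-injective; ↑ʳ-injective)
open import Data.Fin.Subset
  using (Subset; inside; outside; _∈_; _∉_; _⊆_; _⊂_; _-_; _─_; ⊤; ⊥; ⁅_⁆; _∪_; ∣_∣)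
open import Data.Fin.Subset.Properties
  using (_∈?_; nonempty?; ∈⊤; ∉⊥; x∈⁅x⁆; x∈⁅y⁆⇒x≡y; x∈p∪q⁺; x∈p∪q⁻;
         x∈p∧x≢y⇒x∈p-y; x∈p⇒p-x⊂p; p─q⊆p; ⊆-⊂-trans)
open import Data.Fin.Subset.Induction using (⊂-wellFounded)
open import Data.Product using (_×_; _,_; ∃-syntax; proj₁; proj₂; map₂)
open import Data.Sum using (_⊎_; inj₁; inj₂)
open import Data.Vec as Vec using (Vec; []; _∷_; lookup; _[_]≔_; here; there; replicate)
open import Data.Vec.Properties
  using (lookup∘update; lookup∘update′; lookup∘tabulate; lookup⇒[]=; []=⇒lookup)
open import Data.List as List using (List; []; _∷_; length; map; allFin; filter; take; foldl)
open import Data.List.Properties using (length-take)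
open import Data.List.Relation.Unary.All as All using (All; []; _∷_)
import Data.List.Relation.Unary.All.Properties as All
open import Data.List.Relation.Unary.AllPairs using ([]; _∷_)
open import Data.List.Relation.Unary.Any using (here; there)
open import Data.List.Relation.Unary.Unique.Propositional using (Unique)
import Data.List.Relation.Unary.Unique.Propositional.Properties as Unique
open import Data.List.Membership.Propositional using () renaming (_∈_ to _∈ₗ_)
import Data.List.Membership.DecPropositional as DecMembership
open import Function using (_∘_; id)
open import Induction.WellFounded using (Acc; acc)
open import Relation.Binary using (tri<; tri≈; tri>)
open import Relation.Nullary
open import Relation.Nullary.Decidable using (decidable-stable; dec-true)
open import Relation.Binary.PropositionalEquality
open import Algebra.Properties.CommutativeSemigroup *-commutativeSemigroup
  using (x∙yz≈y∙xz; xy∙z≈y∙xz)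
open import Algebra.Properties.Semiring.Sum +-*-semiring
  using (sum; sum-cong-≗; ∑-distrib-+; ∑-comm; *-distribˡ-sum)

private variable
  n k : ℕ
  P Q : Set

-- Indicators and finite sums.

𝟙 : Dec P → ℕ
𝟙 (yes _) = 1
𝟙 (no  _) = 0

𝟙-yes : (p? : Dec P) → P → 𝟙 p? ≡ 1
𝟙-yes (yes _) p = refl
𝟙-yes (no ¬p) p = contradiction p ¬p

𝟙-no : (p? : Dec P) → ¬ P → 𝟙 p? ≡ 0
𝟙-no (yes p) ¬p = contradiction p ¬p
𝟙-no (no _)  ¬p = refl

𝟙-mono : (p? : Dec P) (q? : Dec Q) → (P → Q) → 𝟙 p? ≤ 𝟙 q?
𝟙-mono (yes p) q? f = ≤-reflexive (sym (𝟙-yes q? (f p)))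
𝟙-mono (no _)  q? f = z≤n

𝟙-cong : (p? : Dec P) (q? : Dec Q) → (P → Q) → (Q → P) → 𝟙 p? ≡ 𝟙 q?
𝟙-cong p? q? f g = ≤-antisym (𝟙-mono p? q? f) (𝟙-mono q? p? g)

𝟙≤1 : (p? : Dec P) → 𝟙 p? ≤ 1
𝟙≤1 (yes _) = ≤-refl
𝟙≤1 (no _)  = z≤n

𝟙-pos : (p? : Dec P) → 0 < 𝟙 p? → P
𝟙-pos (yes p) _ = p

∑-mono : (f g : Fin n → ℕ) → (∀ i → f i ≤ g i) → sum f ≤ sum g
∑-mono {zero}  f g f≤g = z≤n
∑-mono {suc n} f g f≤g = +-mono-≤ (f≤g zero) (∑-mono (f ∘ suc) (g ∘ suc) (f≤g ∘ suc))

∑-mono-< : (f g : Fin n → ℕ) → (∀ i → f i ≤ g i) → ∀ i → f i < g i → sum f < sum g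
∑-mono-< f g f≤g zero    fi<gi = +-mono-<-≤ fi<gi (∑-mono (f ∘ suc) (g ∘ suc) (f≤g ∘ suc))
∑-mono-< f g f≤g (suc i) fi<gi =
  +-mono-≤-< (f≤g zero) (∑-mono-< (f ∘ suc) (g ∘ suc) (f≤g ∘ suc) i fi<gi)

term≤∑ : (f : Fin n → ℕ) → ∀ i → f i ≤ sum f
term≤∑ f zero    = m≤m+n (f zero) _
term≤∑ f (suc i) = ≤-trans (term≤∑ (f ∘ suc) i) (m≤n+m _ (f zero))

two-terms≤∑ : (f : Fin n → ℕ) → ∀ {i j} → i ≢ j → f i + f j ≤ sum f
two-terms≤∑ f {zero}  {zero}  i≢j = contradiction refl i≢j
two-terms≤∑ f {zero}  {suc j} i≢j = +-monoʳ-≤ (f zero) (term≤∑ (f ∘ suc) j)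
two-terms≤∑ f {suc i} {zero}  i≢j = ≤-trans (≤-reflexive (+-comm (f (suc i)) (f zero)))
  (+-monoʳ-≤ (f zero) (term≤∑ (f ∘ suc) i))
two-terms≤∑ f {suc i} {suc j} i≢j = m≤n⇒m≤o+n (f zero) (two-terms≤∑ (f ∘ suc) (i≢j ∘ cong suc))

∑-const : ∀ n c → sum {n} (λ _ → c) ≡ n * c
∑-const zero    c = refl
∑-const (suc n) c = cong (c +_) (∑-const n c)

∑-pos : (f : Fin n → ℕ) → 0 < sum f → ∃[ i ] 0 < f i
∑-pos {suc n} f 0<∑ with f zero in eq
... | suc _ = zero , subst (0 <_) (sym eq) z<s
... | zero  = let i , 0<fi = ∑-pos (f ∘ suc) 0<∑ in suc i , 0<fi

∑-𝟙≡ : (b : Fin k) → sum (λ a → 𝟙 (a ≟ b)) ≤ 1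
∑-𝟙≡ {suc k} zero = s≤s (≤-reflexive (trans (sum-cong-≗ {k} {λ a → 𝟙 (suc a ≟ zero)} {λ _ → 0} (λ a → 𝟙-no (suc a ≟ zero) (λ ())))
  (trans (∑-const k 0) (*-zeroʳ k))))
∑-𝟙≡ {suc k} (suc b) = ≤-trans (∑-mono {k} (λ a → 𝟙 (suc a ≟ suc b)) (λ a → 𝟙 (a ≟ b)) (λ a → 𝟙-mono (suc a ≟ suc b) (a ≟ b) (λ { refl → refl })))
  (∑-𝟙≡ b)

-- Counting over all colourings, and resampling one coordinate.

∑Ω : ∀ n {k} → (Vec (Fin k) n → ℕ) → ℕ
∑Ω zero    φ = φ []
∑Ω (suc n) φ = sum λ a → ∑Ω n λ w → φ (a ∷ w)

∑Ω-mono : ∀ n (φ ψ : Vec (Fin k) n → ℕ) → (∀ w → φ w ≤ ψ w) → ∑Ω n φ ≤ ∑Ω n ψ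
∑Ω-mono zero    φ ψ φ≤ψ = φ≤ψ []
∑Ω-mono (suc n) φ ψ φ≤ψ =
  ∑-mono _ _ λ a → ∑Ω-mono n (φ ∘ (a ∷_)) (ψ ∘ (a ∷_)) λ w → φ≤ψ (a ∷ w)

∑Ω-cong : ∀ n (φ ψ : Vec (Fin k) n → ℕ) → (∀ w → φ w ≡ ψ w) → ∑Ω n φ ≡ ∑Ω n ψ
∑Ω-cong n φ ψ φ≡ψ =
  ≤-antisym (∑Ω-mono n φ ψ (≤-reflexive ∘ φ≡ψ)) (∑Ω-mono n ψ φ (≤-reflexive ∘ sym ∘ φ≡ψ))

∑Ω-+ : ∀ n (φ ψ : Vec (Fin k) n → ℕ) → ∑Ω n (λ w → φ w + ψ w) ≡ ∑Ω n φ + ∑Ω n ψ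
∑Ω-+ zero    φ ψ = refl
∑Ω-+ (suc n) φ ψ = trans (sum-cong-≗ λ a → ∑Ω-+ n (φ ∘ (a ∷_)) (ψ ∘ (a ∷_)))
  (∑-distrib-+ (λ a → ∑Ω n (φ ∘ (a ∷_))) (λ a → ∑Ω n (ψ ∘ (a ∷_))))

∑Ω-* : ∀ n c (φ : Vec (Fin k) n → ℕ) → ∑Ω n (λ w → c * φ w) ≡ c * ∑Ω n φ
∑Ω-* zero    c φ = refl
∑Ω-* (suc n) c φ = trans (sum-cong-≗ λ a → ∑Ω-* n c (φ ∘ (a ∷_)))
  (sym (*-distribˡ-sum c λ a → ∑Ω n (φ ∘ (a ∷_))))

∑Ω-∑ : ∀ n {m} (φ : Fin m → Vec (Fin k) n → ℕ) →
       ∑Ω n (λ w → sum λ e → φ e w) ≡ sum λ e → ∑Ω n (φ e)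
∑Ω-∑ zero    φ = refl
∑Ω-∑ (suc n) {m} φ = trans (sum-cong-≗ λ a → ∑Ω-∑ n (λ e w → φ e (a ∷ w)))
  (∑-comm {_} {m} λ a e → ∑Ω n (φ e ∘ (a ∷_)))

term≤∑Ω : ∀ n (φ : Vec (Fin k) n → ℕ) w → φ w ≤ ∑Ω n φ
term≤∑Ω zero    φ []      = ≤-refl
term≤∑Ω (suc n) φ (a ∷ w) = ≤-trans (term≤∑Ω n (φ ∘ (a ∷_)) w) (term≤∑ (λ b → ∑Ω n (φ ∘ (b ∷_))) a)

∑Ω-pos : ∀ n (φ : Vec (Fin k) n → ℕ) → 0 < ∑Ω n φ → ∃[ w ] 0 < φ w
∑Ω-pos zero    φ 0<φ = [] , 0<φ
∑Ω-pos (suc n) φ 0<∑ =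
  let a , 0<a = ∑-pos (λ a → ∑Ω n (φ ∘ (a ∷_))) 0<∑
      w , 0<w = ∑Ω-pos n (φ ∘ (a ∷_)) 0<a
  in a ∷ w , 0<w

-- Every colouring arises as `w [ y ]≔ a` from exactly `k` pairs `(w , a)`, one for each overwritten
-- value at `y`.
∑Ω-resample : ∀ n (φ : Vec (Fin k) n → ℕ) y →
              ∑Ω n (λ w → sum λ a → φ (w [ y ]≔ a)) ≡ k * ∑Ω n φ
∑Ω-resample {k} (suc n) φ zero = trans
  (sum-cong-≗ {k} λ _ → ∑Ω-∑ n λ a w → φ (a ∷ w))
  (∑-const k _)
∑Ω-resample {k} (suc n) φ (suc y) = trans
  (sum-cong-≗ λ b → ∑Ω-resample n (φ ∘ (b ∷_)) y)
  (sym (*-distribˡ-sum k λ b → ∑Ω n (φ ∘ (b ∷_))))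

Invariant : (Vec (Fin k) n → ℕ) → Fin n → Set
Invariant φ y = ∀ w a → φ (w [ y ]≔ a) ≡ φ w

Agree : Vec (Fin k) n → Fin n → List (Fin n) → Set
Agree w u = All λ y → lookup w y ≡ lookup w u

agree? : (w : Vec (Fin k) n) (u : Fin n) (ys : List (Fin n)) → Dec (Agree w u ys)
agree? w u = All.all? λ y → lookup w y ≟ lookup w u

-- Independence of events in counting form. Resampling the head `y` changes neither `φ` nor the
-- colour of `u` nor the agreement of the remaining vertices, and at most one of the `k` new colours
-- equals that of `u`. So each vertex of the list costs a factor `k`.
∑Ω-agree : ∀ (φ : Vec (Fin k) n → ℕ) u ys → Unique ys → All (_≢ u) ys → All (Invariant φ) ys →
           k ^ length ys * ∑Ω n (λ w → φ w * 𝟙 (agree? w u ys)) ≤ ∑Ω n φ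
∑Ω-agree {k} {n} φ u [] _ _ _ = ≤-reflexive (trans (*-identityˡ _) (∑Ω-cong n _ _ λ w → *-identityʳ _))
∑Ω-agree {k} {n} φ u (y ∷ ys) (y∉ys ∷ ys!) (y≢u ∷ ys≢u) (φy ∷ φys) = begin
  k ^ suc l * ∑Ω n (λ w → φ w * 𝟙 (agree? w u (y ∷ ys)))
    ≡⟨ xy∙z≈y∙xz k (k ^ l) _ ⟩
  k ^ l * (k * ∑Ω n (λ w → φ w * 𝟙 (agree? w u (y ∷ ys))))
    ≡⟨ cong (k ^ l *_) (∑Ω-resample n _ y) ⟨
  k ^ l * ∑Ω n (λ w → sum λ a → φ (w [ y ]≔ a) * 𝟙 (agree? (w [ y ]≔ a) u (y ∷ ys)))
    ≤⟨ *-monoʳ-≤ (k ^ l) (∑Ω-mono n _ _ λ w → resampled w) ⟩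
  k ^ l * ∑Ω n (λ w → φ w * 𝟙 (agree? w u ys))
    ≤⟨ ∑Ω-agree φ u ys ys! ys≢u φys ⟩
  ∑Ω n φ ∎
  where
  open ≤-Reasoning
  l = length ys
  back : ∀ w a zs → All (y ≢_) zs → Agree (w [ y ]≔ a) u zs → Agree w u zs
  back w a []       _           _         = []
  back w a (z ∷ zs) (y≢z ∷ y∉zs) (eq ∷ eqs) =
    trans (sym (lookup∘update′ (≢-sym y≢z) w a)) (trans eq (lookup∘update′ (≢-sym y≢u) w a)) ∷ back w a zs y∉zs eqs
  pointwise : ∀ w a → φ (w [ y ]≔ a) * 𝟙 (agree? (w [ y ]≔ a) u (y ∷ ys))
                      ≤ φ w * 𝟙 (agree? w u ys) * 𝟙 (a ≟ lookup w u)
  pointwise w a with agree? (w [ y ]≔ a) u (y ∷ ys)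
  ... | no _ = ≤-trans (≤-reflexive (*-zeroʳ (φ (w [ y ]≔ a)))) z≤n
  ... | yes (eq ∷ eqs)
    rewrite 𝟙-yes (agree? w u ys) (back w a ys y∉ys eqs)
          | 𝟙-yes (a ≟ lookup w u) (trans (sym (lookup∘update y w a)) (trans eq (lookup∘update′ (≢-sym y≢u) w a)))
          | φy w a
          = ≤-reflexive (sym (*-identityʳ _))
  resampled : ∀ w → sum (λ a → φ (w [ y ]≔ a) * 𝟙 (agree? (w [ y ]≔ a) u (y ∷ ys)))
                    ≤ φ w * 𝟙 (agree? w u ys)
  resampled w = begin
    sum (λ a → φ (w [ y ]≔ a) * 𝟙 (agree? (w [ y ]≔ a) u (y ∷ ys))) ≤⟨ ∑-mono _ _ (pointwise w) ⟩
    sum (λ a → c * 𝟙 (a ≟ lookup w u))    ≡⟨ *-distribˡ-sum c (λ a → 𝟙 (a ≟ lookup w u)) ⟨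
    c * sum (λ a → 𝟙 (a ≟ lookup w u))    ≤⟨ *-monoʳ-≤ c (∑-𝟙≡ (lookup w u)) ⟩
    c * 1                                  ≡⟨ *-identityʳ c ⟩
    c                                      ∎
    where c = φ w * 𝟙 (agree? w u ys)

-- Deleting vertices from sets and from edges.

x∈p─q⇒x∉q : ∀ (p q : Subset n) {x} → x ∈ p ─ q → x ∉ q
x∈p─q⇒x∉q (_ ∷ p) (inside  ∷ q) (there x∈) (there x∈q) = x∈p─q⇒x∉q p q x∈ x∈q
x∈p─q⇒x∉q (_ ∷ p) (outside ∷ q) (there x∈) (there x∈q) = x∈p─q⇒x∉q p q x∈ x∈q

x∉p-x : ∀ (p : Subset n) x → x ∉ p - x
x∉p-x p x x∈ = x∈p─q⇒x∉q p _ x∈ (x∈⁅x⁆ x)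

-- Splits an edge at a reference vertex `u`: agreement with `u` concerns only the other vertices,
-- and these can be resampled without changing the colour of `u`.
record Extraction {A : Set} (u : A) (xs : List A) : Set where
  field
    rest   : List A
    len    : length xs ≡ suc (length rest)
    rest!  : Unique rest
    rest≢u : All (_≢ u) rest
    rest⊆  : ∀ {y} → y ∈ₗ rest → y ∈ₗ xs

extract : {A : Set} {u : A} {xs : List A} → Unique xs → u ∈ₗ xs → Extraction u xs
extract (x∉ ∷ xs!) (here refl) = record
  { rest = _ ; len = refl ; rest! = xs! ; rest≢u = All.map ≢-sym x∉ ; rest⊆ = there }
extract {u = u} {x ∷ xs} (x∉ ∷ xs!) (there u∈) = record
  { rest = x ∷ rest ; len = cong suc len
  ; rest! = All.tabulate (λ y∈ → All.lookup x∉ (rest⊆ y∈)) ∷ rest!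
  ; rest≢u = All.lookup x∉ u∈ ∷ rest≢u
  ; rest⊆ = λ { (here eq) → here eq ; (there y∈) → there (rest⊆ y∈) } }
  where open Extraction (extract xs! u∈)

infixl 5 _∖_

_∖_ : Subset n → List (Fin n) → Subset n
_∖_ = foldl _-_

∖-⊆ : ∀ (p : Subset n) ys → p ∖ ys ⊆ p
∖-⊆ p []       = id
∖-⊆ p (y ∷ ys) = p─q⊆p p _ ∘ ∖-⊆ (p - y) ys

y∉p∖ys : ∀ (p : Subset n) ys → All (_∉ p ∖ ys) ys
y∉p∖ys p []       = []
y∉p∖ys p (y ∷ ys) = (x∉p-x p y ∘ ∖-⊆ (p - y) ys) ∷ y∉p∖ys (p - y) ys

-- Rosenfeld's counting argument for uniform hypergraphs.

-- Agreement is required of all pairs, so that any vertex of the edge can serve as the reference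
-- vertex.
Mono : Vec (Fin k) n → List (Fin n) → Set
Mono w e = All (λ u → Agree w u e) e

mono? : (w : Vec (Fin k) n) (e : List (Fin n)) → Dec (Mono w e)
mono? w e = All.all? (λ u → agree? w u e) e

mono-cong : ∀ (w w′ : Vec (Fin k) n) e → All (λ y → lookup w y ≡ lookup w′ y) e → Mono w e → Mono w′ e
mono-cong w w′ e w≈w′ mono = All.tabulate λ u∈ → All.tabulate λ y∈ →
  trans (sym (All.lookup w≈w′ y∈)) (trans (All.lookup (All.lookup mono u∈) y∈) (All.lookup w≈w′ u∈))

-- Divided out, `bound` reads D (r+1) ((r+1)/r)^r ≤ k^r. One edge at a new vertex spoils at most the
-- fraction ((r+1)/r)^r / k^r of the good colourings, so the at most `D` edges there together spoil
-- at most the fraction 1/(r+1).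
module Hypergraph {n m k r D : ℕ} .{{_ : NonZero k}} .{{_ : NonZero r}}
  (edge : Fin m → List (Fin n))
  (uniform : ∀ e → length (edge e) ≡ suc r)
  (edge! : ∀ e → Unique (edge e))
  (_∈ₑ?_ : ∀ (u : Fin n) e → Dec (u ∈ₗ edge e))
  (degree≤ : ∀ u → sum (λ e → 𝟙 (u ∈ₑ? e)) ≤ D)
  (bound : D * suc r * suc r ^ r ≤ k ^ r * r ^ r)
  where

  -- Colourings are total, and the vertices outside `S` are free coordinates. All counts thus range
  -- over the same space, and `#good (S - u)` can be compared directly with `#good S`.
  Good : Subset n → Vec (Fin k) n → Set
  Good S w = ∀ e → All (_∈ S) (edge e) → ¬ Mono w (edge e)

  good? : ∀ S w → Dec (Good S w)
  good? S w = all? λ e → All.all? (_∈? S) (edge e) →-dec ¬? (mono? w (edge e))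

  #good : Subset n → ℕ
  #good S = ∑Ω n λ w → 𝟙 (good? S w)

  good-anti : ∀ {S S′} w → S ⊆ S′ → Good S′ w → Good S w
  good-anti w S⊆S′ good e e⊆S = good e (All.map S⊆S′ e⊆S)

  #good-anti : ∀ {S S′} → S ⊆ S′ → #good S′ ≤ #good S
  #good-anti S⊆S′ = ∑Ω-mono n _ _ λ w → 𝟙-mono (good? _ w) (good? _ w) (good-anti w S⊆S′)

  good-update : ∀ S y (w w′ : Vec (Fin k) n) → (∀ z → z ≢ y → lookup w z ≡ lookup w′ z) →
                y ∉ S → Good S w → Good S w′
  good-update S y w w′ w≈w′ y∉S good e e⊆S mono = good e e⊆S
    (mono-cong w′ w (edge e) (All.map (λ z∈S → sym (w≈w′ _ λ { refl → y∉S z∈S })) e⊆S) mono)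

  -- An edge inside `S` avoids `y`, so recolouring `y` cannot affect it.
  good-invariant : ∀ S {y} → y ∉ S → Invariant (λ w → 𝟙 (good? S w)) y
  good-invariant S {y} y∉S w a = 𝟙-cong (good? S (w [ y ]≔ a)) (good? S w)
    (good-update S y (w [ y ]≔ a) w (λ z z≢y → lookup∘update′ z≢y w a) y∉S)
    (good-update S y w (w [ y ]≔ a) (λ z z≢y → sym (lookup∘update′ z≢y w a)) y∉S)

  -- Each deletion raises the count by a factor of at most (r+1)/r. The ratio is assumed for all
  -- subsets of `S` because the set shrinks along the way.
  chain : ∀ S → (∀ T → T ⊆ S → ∀ y → r * #good (T - y) ≤ suc r * #good T) →
          ∀ ys T → T ⊆ S → r ^ length ys * #good (T ∖ ys) ≤ suc r ^ length ys * #good T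
  chain S step []       T T⊆S = ≤-refl
  chain S step (y ∷ ys) T T⊆S = begin
    r * r ^ l * #good (T - y ∖ ys)        ≡⟨ *-assoc r _ _ ⟩
    r * (r ^ l * #good (T - y ∖ ys))      ≤⟨ *-monoʳ-≤ r (chain S step ys (T - y) (T⊆S ∘ p─q⊆p T _)) ⟩
    r * (suc r ^ l * #good (T - y))       ≡⟨ x∙yz≈y∙xz r (suc r ^ l) _ ⟩
    suc r ^ l * (r * #good (T - y))       ≤⟨ *-monoʳ-≤ (suc r ^ l) (step T T⊆S y) ⟩
    suc r ^ l * (suc r * #good T)         ≡⟨ x∙yz≈y∙xz (suc r ^ l) (suc r) _ ⟩
    suc r * (suc r ^ l * #good T)         ≡⟨ *-assoc (suc r) (suc r ^ l) (#good T) ⟨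
    suc r * suc r ^ l * #good T           ∎
    where
    open ≤-Reasoning
    l = length ys

  #mono : Subset n → Fin m → ℕ
  #mono S e = ∑Ω n λ w → 𝟙 (good? S w) * 𝟙 (mono? w (edge e))

  -- Deleting the r other vertices of e from S makes goodness independent of
  -- the event that they all receive the colour of u.
  #mono≤ : ∀ S → (∀ T → T ⊆ S → ∀ y → r * #good (T - y) ≤ suc r * #good T) →
          ∀ {u e} → u ∈ₗ edge e → k ^ r * r ^ r * #mono S e ≤ suc r ^ r * #good S
  #mono≤ S step {u} {e} u∈e = begin
    k ^ r * r ^ r * #mono S e
      ≡⟨ xy∙z≈y∙xz (k ^ r) (r ^ r) _ ⟩
    r ^ r * (k ^ r * #mono S e)
      ≤⟨ *-monoʳ-≤ (r ^ r) (*-monoʳ-≤ (k ^ r) (∑Ω-mono n _ _ λ w →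
           *-mono-≤ (𝟙-mono (good? S w) (good? S₀ w) (good-anti w (∖-⊆ S ys)))
                    (𝟙-mono (mono? w (edge e)) (agree? w u ys) (mono⇒agree w)))) ⟩
    r ^ r * (k ^ r * ∑Ω n (λ w → 𝟙 (good? S₀ w) * 𝟙 (agree? w u ys)))
      ≤⟨ *-monoʳ-≤ (r ^ r) (subst (λ l → k ^ l * ∑Ω n (λ w → 𝟙 (good? S₀ w) * 𝟙 (agree? w u ys)) ≤ #good S₀) len-ys
           (∑Ω-agree (λ w → 𝟙 (good? S₀ w)) u ys rest! rest≢u
             (All.map (good-invariant S₀) (y∉p∖ys S ys)))) ⟩
    r ^ r * #good S₀
      ≤⟨ subst (λ l → r ^ l * #good S₀ ≤ suc r ^ l * #good S) len-ys (chain S step ys S id) ⟩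
    suc r ^ r * #good S ∎
    where
    open ≤-Reasoning
    open Extraction (extract (edge! e) u∈e) renaming (rest to ys)
    S₀ = S ∖ ys
    len-ys : length ys ≡ r
    len-ys = suc-injective (trans (sym len) (uniform e))
    mono⇒agree : ∀ w → Mono w (edge e) → Agree w u ys
    mono⇒agree w mono = All.tabulate λ y∈ → All.lookup (All.lookup mono u∈e) (rest⊆ y∈)

  -- A colouring that is good for `S - u` but not for `S` has a monochromatic edge inside `S`. This
  -- edge contains `u`, since otherwise it would lie inside `S - u`.
  union-bound : ∀ S u → #good (S - u) ≤ #good S + sum λ e → 𝟙 (u ∈ₑ? e) * #mono (S - u) e
  union-bound S u = begin
    #good S′
      ≤⟨ ∑Ω-mono n _ _ pointwise ⟩
    ∑Ω n (λ w → 𝟙 (good? S w) + sum λ e → 𝟙 (u ∈ₑ? e) * (𝟙 (good? S′ w) * 𝟙 (mono? w (edge e))))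
      ≡⟨ ∑Ω-+ n _ _ ⟩
    #good S + ∑Ω n (λ w → sum λ e → 𝟙 (u ∈ₑ? e) * (𝟙 (good? S′ w) * 𝟙 (mono? w (edge e))))
      ≡⟨ cong (#good S +_) (∑Ω-∑ n λ e w → 𝟙 (u ∈ₑ? e) * (𝟙 (good? S′ w) * 𝟙 (mono? w (edge e)))) ⟩
    #good S + (sum λ e → ∑Ω n (λ w → 𝟙 (u ∈ₑ? e) * (𝟙 (good? S′ w) * 𝟙 (mono? w (edge e)))))
      ≡⟨ cong (#good S +_) (sum-cong-≗ λ e → ∑Ω-* n (𝟙 (u ∈ₑ? e)) _) ⟩
    #good S + (sum λ e → 𝟙 (u ∈ₑ? e) * #mono S′ e) ∎
    where
    open ≤-Reasoning
    S′ = S - u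
    pointwise : ∀ w → 𝟙 (good? S′ w) ≤
      𝟙 (good? S w) + sum λ e → 𝟙 (u ∈ₑ? e) * (𝟙 (good? S′ w) * 𝟙 (mono? w (edge e)))
    pointwise w with good? S w | good? S′ w
    ... | yes _ | g′     = ≤-trans (𝟙≤1 g′) (m≤m+n 1 _)
    ... | no _  | no _   = z≤n
    ... | no ¬g | yes g′ with ¬∀⟶∃¬ m _ (λ e → All.all? (_∈? S) (edge e) →-dec ¬? (mono? w (edge e))) ¬g
    ... | e , ¬ok = ≤-trans (≤-reflexive (sym term≡1)) (term≤∑ (λ e → 𝟙 (u ∈ₑ? e) * (1 * 𝟙 (mono? w (edge e)))) e)
      where
      e⊆S : All (_∈ S) (edge e)
      e⊆S = decidable-stable (All.all? (_∈? S) (edge e)) λ ¬⊆ → ¬ok λ ⊆S → contradiction ⊆S ¬⊆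
      mono : Mono w (edge e)
      mono = decidable-stable (mono? w (edge e)) λ ¬mono → ¬ok λ _ → ¬mono
      u∈e : u ∈ₗ edge e
      u∈e = decidable-stable (u ∈ₑ? e) λ u∉e → g′ e
        (All.tabulate λ y∈ → x∈p∧x≢y⇒x∈p-y (All.lookup e⊆S y∈) λ { refl → u∉e y∈ }) mono
      term≡1 : 𝟙 (u ∈ₑ? e) * (1 * 𝟙 (mono? w (edge e))) ≡ 1
      term≡1 = cong₂ (λ a b → a * (1 * b)) (𝟙-yes (u ∈ₑ? e) u∈e) (𝟙-yes (mono? w (edge e)) mono)

  -- Induction on `S` supplies the ratio for all subsets of `S - u`, which is what `#mono≤`
  -- requires. Each edge at `u` then spoils at most the fraction ((r+1)/(k r))^r of the `A`
  -- colourings, and `bound` keeps the sum over these edges at most `A`/(r+1).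
  #good-step : ∀ S → Acc _⊂_ S → ∀ u → r * #good (S - u) ≤ suc r * #good S
  #good-step S (acc rec) u with u ∈? S
  ... | no u∉S = *-mono-≤ (n≤1+n r) (#good-anti λ y∈ → x∈p∧x≢y⇒x∈p-y y∈ λ { refl → u∉S y∈ })
  -- Adding `A` turns `r * A` into `suc r * A`, to which the union bound applies.
  ... | yes u∈S = +-cancelˡ-≤ A _ _ (begin
    A + r * A                  ≤⟨ *-monoʳ-≤ (suc r) (union-bound S u) ⟩
    suc r * (B + Σb)           ≡⟨ *-distribˡ-+ (suc r) B Σb ⟩
    suc r * B + suc r * Σb     ≤⟨ +-monoʳ-≤ (suc r * B) Σb-small ⟩
    suc r * B + A              ≡⟨ +-comm (suc r * B) A ⟩
    A + suc r * B              ∎)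
    where
    open ≤-Reasoning
    S′ = S - u
    A = #good S′
    B = #good S
    K = k ^ r * r ^ r
    Σb = sum λ e → 𝟙 (u ∈ₑ? e) * #mono S′ e
    step : ∀ T → T ⊆ S′ → ∀ y → r * #good (T - y) ≤ suc r * #good T
    step T T⊆S′ = #good-step T (rec (⊆-⊂-trans T⊆S′ (x∈p⇒p-x⊂p u∈S)))
    instance
      K≢0 : NonZero K
      K≢0 = m*n≢0 (k ^ r) (r ^ r) {{m^n≢0 k r}} {{m^n≢0 r r}}
    term : ∀ e → K * (𝟙 (u ∈ₑ? e) * #mono S′ e) ≤ suc r ^ r * A * 𝟙 (u ∈ₑ? e)
    term e with u ∈ₑ? e
    ... | no _ = ≤-trans (≤-reflexive (*-zeroʳ K)) z≤n
    ... | yes u∈e = begin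
      K * (1 * #mono S′ e)    ≡⟨ cong (K *_) (*-identityˡ _) ⟩
      K * #mono S′ e          ≤⟨ #mono≤ S′ step {e = e} u∈e ⟩
      suc r ^ r * A          ≡⟨ *-identityʳ _ ⟨
      suc r ^ r * A * 1      ∎
    K*Σb : K * Σb ≤ suc r ^ r * A * D
    K*Σb = begin
      K * Σb                                                  ≡⟨ *-distribˡ-sum K (λ e → 𝟙 (u ∈ₑ? e) * #mono S′ e) ⟩
      sum (λ e → K * (𝟙 (u ∈ₑ? e) * #mono S′ e))               ≤⟨ ∑-mono _ _ term ⟩
      sum (λ e → suc r ^ r * A * 𝟙 (u ∈ₑ? e))                 ≡⟨ *-distribˡ-sum (suc r ^ r * A) (λ e → 𝟙 (u ∈ₑ? e)) ⟨
      suc r ^ r * A * sum (λ e → 𝟙 (u ∈ₑ? e))                 ≤⟨ *-monoʳ-≤ (suc r ^ r * A) (degree≤ u) ⟩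
      suc r ^ r * A * D                                       ∎
    rearrange : ∀ s p a d → s * (p * a * d) ≡ d * s * p * a
    rearrange = solve-∀
    Σb-small : suc r * Σb ≤ A
    Σb-small = *-cancelˡ-≤ K (begin
      K * (suc r * Σb)                 ≡⟨ x∙yz≈y∙xz K (suc r) Σb ⟩
      suc r * (K * Σb)                 ≤⟨ *-monoʳ-≤ (suc r) K*Σb ⟩
      suc r * (suc r ^ r * A * D)      ≡⟨ rearrange (suc r) (suc r ^ r) A D ⟩
      D * suc r * suc r ^ r * A        ≤⟨ *-monoˡ-≤ A bound ⟩
      K * A                            ∎)

  0<k : 0 < k
  0<k = >-nonZero⁻¹ k

  #good>0 : ∀ S → Acc _⊂_ S → 0 < #good S
  #good>0 S (acc rec) with nonempty? S
  ... | yes (u , u∈S) = *-cancelˡ-< (suc r) 0 (#good S) (begin-strict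
    suc r * 0             ≡⟨ *-zeroʳ (suc r) ⟩
    0                     <⟨ *-mono-≤ (>-nonZero⁻¹ r) (#good>0 (S - u) (rec (x∈p⇒p-x⊂p u∈S))) ⟩
    r * #good (S - u)     ≤⟨ #good-step S (acc rec) u ⟩
    suc r * #good S       ∎)
    where open ≤-Reasoning
  -- Edges have `suc r` vertices, so none lies inside the empty set and even a constant colouring is
  -- good.
  ... | no S-empty = ≤-trans (≤-reflexive (sym (𝟙-yes (good? S w₀) good))) (term≤∑Ω n (λ w → 𝟙 (good? S w)) w₀)
    where
    w₀ : Vec (Fin k) n
    w₀ = replicate n (Fin.fromℕ< 0<k)
    good : Good S w₀
    good e e⊆S _ with edge e | uniform e | e⊆S
    ... | u ∷ _ | _ | u∈S ∷ _ = S-empty (u , u∈S)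

  abstract
    good-colouring : ∃[ w ] (∀ e → ¬ Mono {k} w (edge e))
    good-colouring =
      let w , 0<𝟙 = ∑Ω-pos n (λ w → 𝟙 (good? ⊤ w)) (#good>0 ⊤ (⊂-wellFounded ⊤))
      in w , λ e → 𝟙-pos (good? ⊤ w) 0<𝟙 e (All.tabulate λ _ → ∈⊤)

-- Subsets cut out by predicates, and weighted averages.

module _ {P : Fin n → Set} (P? : ∀ i → Dec (P i)) where

  ⟪_⟫ : Subset n
  ⟪_⟫ = Vec.tabulate (does ∘ P?)

  ∈⟪⟫⁺ : ∀ {i} → P i → i ∈ ⟪_⟫
  ∈⟪⟫⁺ {i} p = lookup⇒[]= i _ (trans (lookup∘tabulate _ i) (dec-true (P? i) p))

  ∈⟪⟫⁻ : ∀ {i} → i ∈ ⟪_⟫ → P i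
  ∈⟪⟫⁻ {i} i∈ with P? i | trans (sym (lookup∘tabulate (does ∘ P?) i)) ([]=⇒lookup i∈)
  ... | yes p | _ = p

∣⟪⟫∣ : {P : Fin n → Set} (P? : ∀ i → Dec (P i)) → ∣ ⟪ P? ⟫ ∣ ≡ sum (𝟙 ∘ P?)
∣⟪⟫∣ {zero}  P? = refl
∣⟪⟫∣ {suc n} P? with P? zero
... | yes _ = cong suc (∣⟪⟫∣ (P? ∘ suc))
... | no  _ = ∣⟪⟫∣ (P? ∘ suc)

sum-map-tabulate : ∀ {A : Set} (f : A → ℕ) (g : Fin n → A) →
                   ListAction.sum (map f (List.tabulate g)) ≡ sum (f ∘ g)
sum-map-tabulate {zero}  f g = refl
sum-map-tabulate {suc n} f g = cong (f (g zero) +_) (sum-map-tabulate f (g ∘ suc))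

-- Otherwise `g` is smaller than `f` at every index of positive weight; since `i` is such an index,
-- the weighted sums would be strictly ordered the other way.
∑-average : (s f g : Fin n → ℕ) → sum (λ i → s i * f i) ≤ sum (λ i → s i * g i) →
            ∀ i → 0 < s i → ∃[ j ] (0 < s j × f j ≤ g j)
∑-average s f g ∑≤ i 0<si with any? (λ j → 0 <? s j ×-dec f j ≤? g j)
... | yes found = found
... | no  none  = contradiction ∑≤ (<⇒≱ (∑-mono-< _ _ (λ j → weak j (s j) refl) i
    (*-monoʳ-< (s i) {{>-nonZero 0<si}} (≰⇒> λ le → none (i , 0<si , le)))))
  where
  weak : ∀ j x → s j ≡ x → s j * g j ≤ s j * f j
  weak j zero    eq rewrite eq = z≤n
  weak j (suc x) eq = *-monoʳ-≤ (s j) (≰⇒≥ λ le → none (j , subst (0 <_) (sym eq) z<s , le))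

-- Independent sets that hit many neighbourhoods.

module _ (G : Graph) where

  private V = Fin (order G)

  adj? : (u v : V) → Dec (Adj G u v ≡ true)
  adj? u v = Adj G u v ≟ᵇ true

  A : V → V → ℕ
  A u v = 𝟙 (adj? u v)

  indicator≡A : ∀ u v → (if Adj G u v then 1 else 0) ≡ A u v
  indicator≡A u v with Adj G u v
  ... | true  = refl
  ... | false = refl

  deg≡∑ : ∀ v → deg G v ≡ sum (A v)
  deg≡∑ v = trans (sum-map-tabulate (λ u → if Adj G v u then 1 else 0) id) (sum-cong-≗ (indicator≡A v))

  ¬adj : ∀ {u v} → Adj G u v ≢ true → Adj G u v ≡ false
  ¬adj {u} {v} ¬a with Adj G u v
  ... | true  = contradiction refl ¬a
  ... | false = refl

  Adj-symmetric : ∀ {u v} → Adj G u v ≡ true → Adj G v u ≡ true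
  Adj-symmetric {u} {v} a = trans (Adj-sym G v u) a

  Hit : Subset (order G) → V → Set
  Hit I v = ∃[ u ] (Adj G v u ≡ true × u ∈ I)

  hit? : ∀ I v → Dec (Hit I v)
  hit? I v = any? λ u → adj? v u ×-dec u ∈? I

  ∪⁅⁆-independent : ∀ {I z} → IsIndependent G I → (∀ u → u ∈ I → Adj G z u ≡ false) →
                    IsIndependent G (I ∪ ⁅ z ⁆)
  ∪⁅⁆-independent {I} {z} ind free u v u∈ v∈ with x∈p∪q⁻ I ⁅ z ⁆ u∈ | x∈p∪q⁻ I ⁅ z ⁆ v∈
  ... | inj₁ u∈I | inj₁ v∈I = ind u v u∈I v∈I
  ... | inj₁ u∈I | inj₂ v≡z rewrite x∈⁅y⁆⇒x≡y z v≡z = trans (Adj-sym G u z) (free u u∈I)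
  ... | inj₂ u≡z | inj₁ v∈I rewrite x∈⁅y⁆⇒x≡y z u≡z = free v v∈I
  ... | inj₂ u≡z | inj₂ v≡z rewrite x∈⁅y⁆⇒x≡y z u≡z | x∈⁅y⁆⇒x≡y z v≡z = irrefl G z

  -- While `I` grows and the set `S` of available vertices shrinks, the potential `Φ` is kept from
  -- dropping. With all vertices available it is at least the weighted degree sum on the left. Once
  -- none is available, unhit vertices contribute nothing and it is at most the right side.
  independent-hitting : ∀ Δ → (∀ v → deg G v ≤ Δ) → (t : V → ℕ) →
    ∃[ I ] (IsIndependent G I × sum (λ v → t v * deg G v) ≤ 2 * Δ * sum (λ v → t v * 𝟙 (hit? I v)))
  independent-hitting Δ deg≤Δ t =
    map₂ (map₂ (≤-trans (∑-mono _ _ λ v → *-monoʳ-≤ (t v) (deg≤pot v))))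
      (greedy ⊥ ⊤ (⊂-wellFounded ⊤) (λ _ _ u∈⊥ → contradiction u∈⊥ ∉⊥) (λ _ _ _ u∈⊥ → contradiction u∈⊥ ∉⊥))
    where
    open ≤-Reasoning

    s : Subset (order G) → V → ℕ
    s S u = 𝟙 (u ∈? S)

    avail : Subset (order G) → V → ℕ
    avail S v = sum λ u → A v u * s S u

    -- A hit vertex is worth `2 * Δ` rather than `Δ`: one `Δ` covers the availability it had, and
    -- the other pays for what `v` loses under those choices of `z` that do not hit it.
    pot : Subset (order G) → Subset (order G) → V → ℕ
    pot I S v with hit? I v
    ... | yes _ = 2 * Δ
    ... | no  _ = avail S v

    Φ : Subset (order G) → Subset (order G) → ℕ
    Φ I S = sum λ v → t v * pot I S v

    deg≤pot : ∀ v → deg G v ≤ pot ⊥ ⊤ v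
    deg≤pot v with hit? ⊥ v
    ... | yes (_ , _ , u∈⊥) = contradiction u∈⊥ ∉⊥
    ... | no _ = begin
      deg G v       ≡⟨ deg≡∑ v ⟩
      sum (A v)     ≡⟨ sum-cong-≗ (λ u → trans (cong (A v u *_) (𝟙-yes (u ∈? ⊤) ∈⊤)) (*-identityʳ (A v u))) ⟨
      avail ⊤ v     ∎

    avail≤Δ : ∀ S v → avail S v ≤ Δ
    avail≤Δ S v = begin
      avail S v   ≤⟨ ∑-mono _ _ (λ u → ≤-trans (*-monoʳ-≤ (A v u) (𝟙≤1 (u ∈? S))) (≤-reflexive (*-identityʳ _))) ⟩
      sum (A v)   ≡⟨ deg≡∑ v ⟨
      deg G v     ≤⟨ deg≤Δ v ⟩
      Δ           ∎

    survives? : ∀ S z u → Dec (u ∈ S × u ≢ z × Adj G z u ≢ true)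
    survives? S z u = u ∈? S ×-dec ¬? (u ≟ z) ×-dec ¬? (adj? z u)

    shrink : Subset (order G) → V → Subset (order G)
    shrink S z = ⟪ survives? S z ⟫

    shrink-⊂ : ∀ {S z} → z ∈ S → shrink S z ⊂ S
    shrink-⊂ {S} {z} z∈S = (λ u∈ → proj₁ (∈⟪⟫⁻ (survives? S z) u∈)) ,
      z , z∈S , λ z∈ → proj₁ (proj₂ (∈⟪⟫⁻ (survives? S z) z∈)) refl

    shrink-free : ∀ {I S z} → (∀ w → w ∈ S → ∀ u → u ∈ I → Adj G w u ≡ false) →
                  ∀ w → w ∈ shrink S z → ∀ u → u ∈ I ∪ ⁅ z ⁆ → Adj G w u ≡ false
    shrink-free {I} {S} {z} free w w∈ u u∈ with ∈⟪⟫⁻ (survives? S z) w∈ | x∈p∪q⁻ I ⁅ z ⁆ u∈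
    ... | w∈S , _ , _   | inj₁ u∈I = free w w∈S u u∈I
    ... | _   , _ , ¬zw | inj₂ u≡z rewrite x∈⁅y⁆⇒x≡y z u≡z = ¬adj (¬zw ∘ Adj-symmetric)

    -- Choosing z either hits v or costs v only the available neighbours it shares with z.
    -- Hence Φ does not drop on average over the available z, so some z does not lower it.
    pot-step : ∀ I S z v → ¬ Hit I v →
      avail S v + A v z * Δ ≤ pot (I ∪ ⁅ z ⁆) (shrink S z) v + sum (λ u → A v u * s S u * A u z)
    pot-step I S z v ¬hit with hit? (I ∪ ⁅ z ⁆) v
    ... | yes _ = m≤n⇒m≤n+o _ (begin
      avail S v + A v z * Δ   ≤⟨ +-mono-≤ (avail≤Δ S v) (*-monoˡ-≤ Δ (𝟙≤1 (adj? v z))) ⟩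
      Δ + 1 * Δ               ∎)
    ... | no ¬hit′ = begin
      avail S v + A v z * Δ   ≡⟨ cong (λ x → avail S v + x * Δ) (𝟙-no (adj? v z) ¬vz) ⟩
      avail S v + 0           ≡⟨ +-identityʳ _ ⟩
      avail S v               ≤⟨ ∑-mono _ _ pointwise ⟩
      sum (λ u → A v u * s S′ u + A v u * s S u * A u z)
                              ≡⟨ ∑-distrib-+ (λ u → A v u * s S′ u) (λ u → A v u * s S u * A u z) ⟩
      avail S′ v + sum (λ u → A v u * s S u * A u z) ∎
      where
      S′ = shrink S z
      ¬vz : Adj G v z ≢ true
      ¬vz vz = ¬hit′ (z , vz , x∈p∪q⁺ (inj₂ (x∈⁅x⁆ z)))
      pointwise : ∀ u → A v u * s S u ≤ A v u * s S′ u + A v u * s S u * A u z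
      pointwise u with adj? v u | u ∈? S | adj? u z
      ... | no _   | _       | _      = z≤n
      ... | yes _  | no _    | _      = z≤n
      ... | yes _  | yes _   | yes _  = m≤n+m 1 _
      ... | yes vu | yes u∈S | no ¬uz
        rewrite 𝟙-yes (u ∈? S′) (∈⟪⟫⁺ (survives? S z) (u∈S , (λ { refl → ¬vz vu }) , ¬uz ∘ Adj-symmetric)) = ≤-refl

    -- For an unhit `v`, each available neighbour `z` of `v` brings an extra `Δ`, in total
    -- `avail S v * Δ`. The total loss is no larger, so adding this amount to both sides and
    -- cancelling gives the claim.
    pot-average : ∀ I S v →
      sum (λ z → s S z * pot I S v) ≤ sum (λ z → s S z * pot (I ∪ ⁅ z ⁆) (shrink S z) v)
    pot-average I S v with hit? I v
    ... | yes (u , vu , u∈I) = ≤-reflexive (sum-cong-≗ λ z → cong (s S z *_) (sym (still-hit z)))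
      where
      still-hit : ∀ z → pot (I ∪ ⁅ z ⁆) (shrink S z) v ≡ 2 * Δ
      still-hit z with hit? (I ∪ ⁅ z ⁆) v
      ... | yes _   = refl
      ... | no ¬hit = contradiction (u , vu , x∈p∪q⁺ (inj₁ u∈I)) ¬hit
    ... | no ¬hit = +-cancelʳ-≤ (avail S v * Δ) _ _ (begin
      sum (λ z → s S z * avail S v) + avail S v * Δ
        ≡⟨ cong (sum (λ z → s S z * avail S v) +_) (trans (*-comm (avail S v) Δ) (*-distribˡ-sum Δ λ z → A v z * s S z)) ⟩
      sum (λ z → s S z * avail S v) + sum (λ z → Δ * (A v z * s S z))
        ≡⟨ ∑-distrib-+ (λ z → s S z * avail S v) (λ z → Δ * (A v z * s S z)) ⟨
      sum (λ z → s S z * avail S v + Δ * (A v z * s S z))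
        ≡⟨ sum-cong-≗ (λ z → factor (s S z) (avail S v) (A v z) Δ) ⟩
      sum (λ z → s S z * (avail S v + A v z * Δ))
        ≤⟨ ∑-mono _ _ (λ z → *-monoʳ-≤ (s S z) (pot-step I S z v ¬hit)) ⟩
      sum (λ z → s S z * (new z + lost z))
        ≡⟨ sum-cong-≗ (λ z → *-distribˡ-+ (s S z) (new z) (lost z)) ⟩
      sum (λ z → s S z * new z + s S z * lost z)
        ≡⟨ ∑-distrib-+ (λ z → s S z * new z) (λ z → s S z * lost z) ⟩
      sum (λ z → s S z * new z) + sum (λ z → s S z * lost z)
        ≤⟨ +-monoʳ-≤ (sum (λ z → s S z * new z)) total-loss ⟩
      sum (λ z → s S z * new z) + avail S v * Δ ∎)
      where
      new lost : V → ℕ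
      new z = pot (I ∪ ⁅ z ⁆) (shrink S z) v
      lost z = sum λ u → A v u * s S u * A u z
      factor : ∀ p a x d → p * a + d * (x * p) ≡ p * (a + x * d)
      factor = solve-∀
      swap : ∀ p a x → p * (a * x) ≡ a * (x * p)
      swap = solve-∀
      -- The sum counts walks v, u, z with `u` and `z` available; summed by `u` first, each `u` has
      -- at most `Δ` continuations.
      total-loss : sum (λ z → s S z * lost z) ≤ avail S v * Δ
      total-loss = begin
        sum (λ z → s S z * lost z)
          ≡⟨ sum-cong-≗ (λ z → *-distribˡ-sum (s S z) (λ u → A v u * s S u * A u z)) ⟩
        sum (λ z → sum λ u → s S z * (A v u * s S u * A u z))
          ≡⟨ ∑-comm (λ z u → s S z * (A v u * s S u * A u z)) ⟩
        sum (λ u → sum λ z → s S z * (A v u * s S u * A u z))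
          ≡⟨ sum-cong-≗ (λ u → trans (sum-cong-≗ λ z → swap (s S z) (A v u * s S u) (A u z))
               (sym (*-distribˡ-sum (A v u * s S u) (λ z → A u z * s S z)))) ⟩
        sum (λ u → A v u * s S u * avail S u)
          ≤⟨ ∑-mono _ _ (λ u → *-monoʳ-≤ (A v u * s S u) (avail≤Δ S u)) ⟩
        sum (λ u → A v u * s S u * Δ)
          ≡⟨ sum-cong-≗ (λ u → *-comm (A v u * s S u) Δ) ⟩
        sum (λ u → Δ * (A v u * s S u))
          ≡⟨ *-distribˡ-sum Δ (λ u → A v u * s S u) ⟨
        Δ * avail S v
          ≡⟨ *-comm Δ (avail S v) ⟩
        avail S v * Δ ∎

    Φ-average : ∀ I S → sum (λ z → s S z * Φ I S) ≤ sum (λ z → s S z * Φ (I ∪ ⁅ z ⁆) (shrink S z))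
    Φ-average I S = begin
      sum (λ z → s S z * Φ I S)
        ≡⟨ exchange (λ _ → pot I S) ⟩
      sum (λ v → t v * sum λ z → s S z * pot I S v)
        ≤⟨ ∑-mono _ _ (λ v → *-monoʳ-≤ (t v) (pot-average I S v)) ⟩
      sum (λ v → t v * sum λ z → s S z * pot (I ∪ ⁅ z ⁆) (shrink S z) v)
        ≡⟨ exchange (λ z → pot (I ∪ ⁅ z ⁆) (shrink S z)) ⟨
      sum (λ z → s S z * Φ (I ∪ ⁅ z ⁆) (shrink S z)) ∎
      where
      exchange : (p : V → V → ℕ) →
        sum (λ z → s S z * sum λ v → t v * p z v) ≡ sum (λ v → t v * sum λ z → s S z * p z v)
      exchange p = trans (sum-cong-≗ λ z → *-distribˡ-sum (s S z) (λ v → t v * p z v))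
        (trans (∑-comm λ z v → s S z * (t v * p z v))
        (sum-cong-≗ λ v → trans (sum-cong-≗ λ z → x∙yz≈y∙xz (s S z) (t v) (p z v))
          (sym (*-distribˡ-sum (t v) λ z → s S z * p z v))))

    greedy : ∀ I S → Acc _⊂_ S → IsIndependent G I → (∀ z → z ∈ S → ∀ u → u ∈ I → Adj G z u ≡ false) →
      ∃[ J ] (IsIndependent G J × Φ I S ≤ 2 * Δ * sum (λ v → t v * 𝟙 (hit? J v)))
    greedy I S (acc rec) ind free with nonempty? S
    ... | no S-empty = I , ind , (begin
      Φ I S                                          ≤⟨ ∑-mono _ _ (λ v → *-monoʳ-≤ (t v) (exhausted v)) ⟩
      sum (λ v → t v * (2 * Δ * 𝟙 (hit? I v)))      ≡⟨ sum-cong-≗ (λ v → x∙yz≈y∙xz (t v) (2 * Δ) (𝟙 (hit? I v))) ⟩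
      sum (λ v → 2 * Δ * (t v * 𝟙 (hit? I v)))      ≡⟨ *-distribˡ-sum (2 * Δ) (λ v → t v * 𝟙 (hit? I v)) ⟨
      2 * Δ * sum (λ v → t v * 𝟙 (hit? I v))        ∎)
      where
      exhausted : ∀ v → pot I S v ≤ 2 * Δ * 𝟙 (hit? I v)
      exhausted v with hit? I v
      ... | yes _ = ≤-reflexive (sym (*-identityʳ (2 * Δ)))
      ... | no _  = ≤-trans (≤-reflexive (trans
        (sum-cong-≗ λ u → trans (cong (A v u *_) (𝟙-no (u ∈? S) λ u∈S → S-empty (u , u∈S))) (*-zeroʳ (A v u)))
        (trans (∑-const (order G) 0) (*-zeroʳ (order G))))) z≤n
    ... | yes (i , i∈S) = continue (∑-average (s S) (λ _ → Φ I S) (λ z → Φ (I ∪ ⁅ z ⁆) (shrink S z))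
        (Φ-average I S) i (≤-reflexive (sym (𝟙-yes (i ∈? S) i∈S))))
      where
      continue : ∃[ z ] (0 < s S z × Φ I S ≤ Φ (I ∪ ⁅ z ⁆) (shrink S z)) →
        ∃[ J ] (IsIndependent G J × Φ I S ≤ 2 * Δ * sum (λ v → t v * 𝟙 (hit? J v)))
      continue (z , 0<sz , Φ≤) = map₂ (map₂ (≤-trans Φ≤))
        (greedy (I ∪ ⁅ z ⁆) (shrink S z) (rec (shrink-⊂ z∈S))
          (∪⁅⁆-independent ind (free z z∈S)) (shrink-free free))
        where
        z∈S : z ∈ S
        z∈S = 𝟙-pos (z ∈? S) 0<sz

-- The estimate (1 + 1/r)^r ≤ 4.

-- Bernoulli's inequality (1 - 1/(r+1))^h ≥ 1 - h/(r+1), with d = r + 1 - h.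
bernoulli : ∀ r h d → h + d ≡ suc r → suc r ^ h * d ≤ r ^ h * suc r
bernoulli r zero    d refl = ≤-refl
bernoulli r (suc h) d eq   = begin
  suc r * suc r ^ h * d     ≡⟨ xy∙z≈y∙xz (suc r) (suc r ^ h) d ⟩
  suc r ^ h * (d + r * d)   ≤⟨ *-monoʳ-≤ (suc r ^ h) (+-monoˡ-≤ (r * d) d≤r) ⟩
  suc r ^ h * (r + r * d)   ≡⟨ lemma (suc r ^ h) r d ⟩
  r * (suc r ^ h * suc d)   ≤⟨ *-monoʳ-≤ r (bernoulli r h (suc d) (trans (+-suc h d) eq)) ⟩
  r * (r ^ h * suc r)       ≡⟨ *-assoc r (r ^ h) (suc r) ⟨
  r * r ^ h * suc r         ∎
  where
  open ≤-Reasoning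
  d≤r : d ≤ r
  d≤r = ≤-trans (m≤n+m d h) (≤-reflexive (suc-injective eq))
  lemma : ∀ a b c → a * (b + b * c) ≡ b * (a * (1 + c))
  lemma = solve-∀

-- Up to half of `suc r`, Bernoulli's bound stays at least 1/2: `h ≤ d` gives `suc r ≤ d + d`.
suc^≤2* : ∀ r h → h + h ≤ suc r → suc r ^ h ≤ 2 * r ^ h
suc^≤2* r h 2h≤ = *-cancelʳ-≤ _ _ (suc r) (begin
  suc r ^ h * suc r         ≡⟨ cong (suc r ^ h *_) h+d ⟨
  suc r ^ h * (h + d)       ≤⟨ *-monoʳ-≤ (suc r ^ h) (+-monoˡ-≤ d h≤d) ⟩
  suc r ^ h * (d + d)       ≡⟨ lemma (suc r ^ h) d ⟩
  2 * (suc r ^ h * d)       ≤⟨ *-monoʳ-≤ 2 (bernoulli r h d h+d) ⟩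
  2 * (r ^ h * suc r)       ≡⟨ *-assoc 2 (r ^ h) (suc r) ⟨
  2 * r ^ h * suc r         ∎)
  where
  open ≤-Reasoning
  d = suc r ∸ h
  h+d : h + d ≡ suc r
  h+d = m+[n∸m]≡n (≤-trans (m≤m+n h h) 2h≤)
  h≤d : h ≤ d
  h≤d = m+n≤o⇒m≤o∸n h 2h≤
  lemma : ∀ a b → a * (b + b) ≡ 2 * (a * b)
  lemma = solve-∀

-- Both halves of the exponent `r` are at most (r+1)/2, and each costs a factor 2. This is the
-- origin of the 4 under the root.
suc^≤4* : ∀ r → suc r ^ r ≤ 4 * r ^ r
suc^≤4* r = begin
  suc r ^ r                         ≡⟨ cong (suc r ^_) (⌊n/2⌋+⌈n/2⌉≡n r) ⟨
  suc r ^ (f + c)                   ≡⟨ ^-distribˡ-+-* (suc r) f c ⟩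
  suc r ^ f * suc r ^ c             ≤⟨ *-mono-≤ (suc^≤2* r f 2f≤) (suc^≤2* r c 2c≤) ⟩
  2 * r ^ f * (2 * r ^ c)           ≡⟨ lemma (r ^ f) (r ^ c) ⟩
  4 * (r ^ f * r ^ c)               ≡⟨ cong (4 *_) (^-distribˡ-+-* r f c) ⟨
  4 * r ^ (f + c)                   ≡⟨ cong (λ x → 4 * r ^ x) (⌊n/2⌋+⌈n/2⌉≡n r) ⟩
  4 * r ^ r                         ∎
  where
  open ≤-Reasoning
  f = ⌊ r /2⌋
  c = ⌈ r /2⌉
  2c≤ : c + c ≤ suc r
  2c≤ = ≤-trans (+-monoʳ-≤ c (⌊n/2⌋≤⌈n/2⌉ (suc r))) (≤-reflexive (⌊n/2⌋+⌈n/2⌉≡n (suc r)))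
  2f≤ : f + f ≤ suc r
  2f≤ = ≤-trans (+-mono-≤ (⌊n/2⌋≤⌈n/2⌉ r) (⌊n/2⌋≤⌈n/2⌉ r)) 2c≤
  lemma : ∀ a b → 2 * a * (2 * b) ≡ 4 * (a * b)
  lemma = solve-∀

-- Bad vertices, and a map under which no neighbourhood is monochromatic.

module _ (G : Graph) where

  private V = Fin (order G)

  SeesTwo : ∀ {m} → (V → Fin m) → V → Set
  SeesTwo c v = ∃[ u ] ∃[ w ] (Adj G v u ≡ true × Adj G v w ≡ true × c u ≢ c w)

  seesTwo? : ∀ {m} (c : V → Fin m) v → Dec (SeesTwo c v)
  seesTwo? c v = any? λ u → any? λ w → adj? G v u ×-dec adj? G v w ×-dec ¬? (c u ≟ c w)

  bad-constant : ∀ {m} (c : V → Fin m) {v} → ¬ SeesTwo c v →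
    ∀ {u w} → Adj G v u ≡ true → Adj G v w ≡ true → c u ≡ c w
  bad-constant c ¬seen vu vw = decidable-stable (c _ ≟ c _) λ cu≢cw → ¬seen (_ , _ , vu , vw , cu≢cw)

  #bad : ∀ {m} → (V → Fin m) → ℕ
  #bad c = sum λ v → 𝟙 (¬? (seesTwo? c v))

  nbrs : V → List V
  nbrs v = filter (adj? G v) (allFin (order G))

  length-filter-adj : ∀ v xs → length (filter (adj? G v) xs) ≡ ListAction.sum (map (λ u → if Adj G v u then 1 else 0) xs)
  length-filter-adj v []       = refl
  length-filter-adj v (x ∷ xs) with Adj G v x
  ... | true  = cong suc (length-filter-adj v xs)
  ... | false = length-filter-adj v xs

  length-nbrs : ∀ v → length (nbrs v) ≡ deg G v
  length-nbrs v = length-filter-adj v (allFin (order G))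

  nbrs! : ∀ v → Unique (nbrs v)
  nbrs! v = Unique.filter⁺ (adj? G v) (Unique.allFin⁺ (order G))

  all-nbrs : ∀ v → All (λ u → Adj G v u ≡ true) (nbrs v)
  all-nbrs v = All.all-filter (adj? G v) (allFin (order G))

  neighbour-avoiding : ∀ v → 2 ≤ deg G v → ∀ u → ∃[ w ] (Adj G v w ≡ true × w ≢ u)
  neighbour-avoiding v 2≤deg u with nbrs v | length-nbrs v | nbrs! v | all-nbrs v
  ... | []        | eq | _ | _ = contradiction (subst (2 ≤_) (sym eq) 2≤deg) λ ()
  ... | _ ∷ []    | eq | _ | _ = contradiction (subst (2 ≤_) (sym eq) 2≤deg) λ { (s≤s ()) }
  ... | x ∷ y ∷ _ | _ | ((x≢y ∷ _) ∷ _) | vx ∷ vy ∷ _ with x ≟ u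
  ... | yes refl = y , vy , ≢-sym x≢y
  ... | no  x≢u  = x , vx , x≢u

  -- The hypergraph has one edge for each vertex `v`, its neighbourhood cut down to `suc r` vertices
  -- to make the edges uniform. A vertex `u` lies only in edges of its own neighbours, hence in at
  -- most `Δ`, and a monochromatic neighbourhood would contain a monochromatic edge.
  all-see-two : ∀ {Δ k r} .{{_ : NonZero k}} .{{_ : NonZero r}} →
    (∀ v → suc r ≤ deg G v) → (∀ v → deg G v ≤ Δ) → Δ * suc r * suc r ^ r ≤ k ^ r * r ^ r →
    ∃[ f ] (∀ v → SeesTwo {k} f v)
  all-see-two {Δ} {k} {r} δ≤ ≤Δ bound =
    let w , ¬mono = good-colouring in lookup w , λ v → decidable-stable (seesTwo? (lookup w) v) λ ¬seen →
      ¬mono v (All.tabulate λ u∈ → All.tabulate λ y∈ →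
        bad-constant (lookup w) ¬seen (edge-adj v y∈) (edge-adj v u∈))
    where
    open ≤-Reasoning
    open DecMembership (_≟_ {order G}) renaming (_∈?_ to _∈ₗ?_)
    edge : V → List V
    edge v = take (suc r) (nbrs v)
    edge-adj : ∀ v {u} → u ∈ₗ edge v → Adj G v u ≡ true
    edge-adj v = All.lookup (All.take⁺ (suc r) (all-nbrs v))
    degree≤ : ∀ u → sum (λ v → 𝟙 (u ∈ₗ? edge v)) ≤ Δ
    degree≤ u = begin
      sum (λ v → 𝟙 (u ∈ₗ? edge v))   ≤⟨ ∑-mono _ _ (λ v → 𝟙-mono (u ∈ₗ? edge v) (adj? G u v) (Adj-symmetric G ∘ edge-adj v)) ⟩
      sum (A G u)                    ≡⟨ deg≡∑ G u ⟨
      deg G u                        ≤⟨ ≤Δ u ⟩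
      Δ                              ∎
    open Hypergraph {k = k} edge
      (λ v → trans (length-take (suc r) (nbrs v)) (m≤n⇒m⊓n≡m (subst (suc r ≤_) (sym (length-nbrs v)) (δ≤ v))))
      (λ v → Unique.take⁺ (suc r) (nbrs! v))
      (λ u v → u ∈ₗ? edge v) degree≤ bound

  -- Recolouring an independent set from a fresh palette.

  module Recolour {m k} (c : V → Fin m) (f : V → Fin k) (I : Subset (order G)) where

    recolour : V → Fin (m + k)
    recolour u with u ∈? I
    ... | yes _ = m ↑ʳ f u
    ... | no  _ = c u ↑ˡ k

    ↑ʳ≢↑ˡ : ∀ {i j} → m ↑ʳ i ≢ j ↑ˡ k
    ↑ʳ≢↑ˡ {i} {j} eq with trans (sym (splitAt-↑ʳ m k i)) (trans (cong (splitAt m) eq) (splitAt-↑ˡ m j k))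
    ... | ()

    recolour-proper : IsProper G c → IsIndependent G I → IsProper G recolour
    recolour-proper proper ind u v uv eq with u ∈? I | v ∈? I
    ... | yes u∈I | yes v∈I = contradiction (trans (sym uv) (ind u v u∈I v∈I)) λ ()
    ... | yes _   | no  _   = ↑ʳ≢↑ˡ eq
    ... | no  _   | yes _   = ↑ʳ≢↑ˡ (sym eq)
    ... | no  _   | no  _   = proper u v uv (↑ˡ-injective k _ _ eq)

    recolour-∈ : ∀ {u} → u ∈ I → recolour u ≡ m ↑ʳ f u
    recolour-∈ {u} u∈I with u ∈? I
    ... | yes _   = refl
    ... | no  u∉I = contradiction u∈I u∉I

    recolour-∉ : ∀ {u} → u ∉ I → recolour u ≡ c u ↑ˡ k
    recolour-∉ {u} u∉I with u ∈? I
    ... | yes u∈I = contradiction u∈I u∉I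
    ... | no  _   = refl

    -- If `v` is not hit, its neighbours keep their old colours. If it has neighbours both inside
    -- and outside `I`, it sees a fresh and an old colour. If all its neighbours lie in `I`, `inner`
    -- provides two fresh colours; restricting `inner` to this case allows the last repair to use a
    -- single fresh colour.
    recolour-seesTwo : (∀ v → (∀ u → Adj G v u ≡ true → u ∈ I) → SeesTwo f v) →
                       ∀ v → Hit G I v ⊎ SeesTwo c v → SeesTwo recolour v
    recolour-seesTwo inner v hit⊎seen with hit? G I v
    ... | no ¬hit with hit⊎seen
    ...   | inj₁ hit = contradiction hit ¬hit
    ...   | inj₂ (u , w , vu , vw , cu≢cw) = u , w , vu , vw , λ eq → cu≢cw (↑ˡ-injective k _ _
            (trans (sym (recolour-∉ λ u∈I → ¬hit (u , vu , u∈I))) (trans eq (recolour-∉ λ w∈I → ¬hit (w , vw , w∈I)))))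
    recolour-seesTwo inner v _ | yes (u , vu , u∈I) with any? (λ w → adj? G v w ×-dec ¬? (w ∈? I))
    ... | yes (w , vw , w∉I) = u , w , vu , vw , λ eq → ↑ʳ≢↑ˡ (trans (sym (recolour-∈ u∈I)) (trans eq (recolour-∉ w∉I)))
    ... | no none =
      let all-in : ∀ w → Adj G v w ≡ true → w ∈ I
          all-in w vw = decidable-stable (w ∈? I) λ w∉I → none (w , vw , w∉I)
          x , y , vx , vy , fx≢fy = inner v all-in
      in x , y , vx , vy , λ eq → fx≢fy (↑ʳ-injective m _ _
        (trans (sym (recolour-∈ (all-in x vx))) (trans eq (recolour-∈ (all-in y vy)))))

  open Recolour

  -- Rounds of recolouring.

  module _ {δ Δ k} (δ≤ : ∀ v → δ ≤ deg G v) (≤Δ : ∀ v → deg G v ≤ Δ)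
           (f : V → Fin k) (f-sees : ∀ v → SeesTwo f v) where

    open ≤-Reasoning

    -- The hitting set is chosen with weight 1 on bad vertices and 0 elsewhere. Every hit bad vertex
    -- is cured and no vertex becomes bad, so at least the fraction `δ`/(2`Δ`) of the bad vertices
    -- disappears.
    one-round : ∀ {m} (c : V → Fin m) → IsProper G c →
      ∃[ c′ ] (IsProper G {m + k} c′ × 2 * Δ * #bad c′ ≤ (2 * Δ ∸ δ) * #bad c)
    one-round {m} c proper with independent-hitting G Δ ≤Δ (λ v → 𝟙 (¬? (seesTwo? c v)))
    ... | I , ind , hits = c′ , recolour-proper c f I proper ind , (begin
      2 * Δ * #bad c′
        ≡⟨ m+n∸n≡m _ (δ * #bad c) ⟨
      2 * Δ * #bad c′ + δ * #bad c ∸ δ * #bad c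
        ≤⟨ ∸-monoˡ-≤ (δ * #bad c) balance ⟩
      2 * Δ * #bad c ∸ δ * #bad c
        ≡⟨ *-distribʳ-∸ (#bad c) (2 * Δ) δ ⟨
      (2 * Δ ∸ δ) * #bad c ∎)
      where
      c′ = recolour c f I
      t : V → ℕ
      t v = 𝟙 (¬? (seesTwo? c v))
      t-hit : V → ℕ
      t-hit v = t v * 𝟙 (hit? G I v)
      seen′ : ∀ v → Hit G I v ⊎ SeesTwo c v → SeesTwo c′ v
      seen′ = recolour-seesTwo c f I λ v _ → f-sees v
      pointwise : ∀ v → 𝟙 (¬? (seesTwo? c′ v)) + t-hit v ≤ t v
      pointwise v with seesTwo? c v | hit? G I v
      ... | yes seen | _ = ≤-reflexive (trans (+-identityʳ _) (𝟙-no (¬? (seesTwo? c′ v)) λ ¬s → ¬s (seen′ v (inj₂ seen))))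
      ... | no _     | yes hit = ≤-reflexive (cong (_+ 1) (𝟙-no (¬? (seesTwo? c′ v)) λ ¬s → ¬s (seen′ v (inj₁ hit))))
      ... | no _     | no _ = ≤-trans (≤-reflexive (+-identityʳ _)) (𝟙≤1 (¬? (seesTwo? c′ v)))
      δ*bad : δ * #bad c ≤ 2 * Δ * sum t-hit
      δ*bad = begin
        δ * #bad c                  ≡⟨ *-distribˡ-sum δ t ⟩
        sum (λ v → δ * t v)         ≤⟨ ∑-mono _ _ (λ v → ≤-trans (*-monoˡ-≤ (t v) (δ≤ v)) (≤-reflexive (*-comm (deg G v) (t v)))) ⟩
        sum (λ v → t v * deg G v)   ≤⟨ hits ⟩
        2 * Δ * sum t-hit           ∎
      balance : 2 * Δ * #bad c′ + δ * #bad c ≤ 2 * Δ * #bad c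
      balance = begin
        2 * Δ * #bad c′ + δ * #bad c               ≤⟨ +-monoʳ-≤ (2 * Δ * #bad c′) δ*bad ⟩
        2 * Δ * #bad c′ + 2 * Δ * sum t-hit        ≡⟨ *-distribˡ-+ (2 * Δ) (#bad c′) (sum t-hit) ⟨
        2 * Δ * (#bad c′ + sum t-hit)              ≡⟨ cong (2 * Δ *_) (∑-distrib-+ (λ v → 𝟙 (¬? (seesTwo? c′ v))) t-hit) ⟨
        2 * Δ * sum (λ v → 𝟙 (¬? (seesTwo? c′ v)) + t-hit v)
                                                   ≤⟨ *-monoʳ-≤ (2 * Δ) (∑-mono _ _ pointwise) ⟩
        2 * Δ * #bad c                             ∎

    -- The palette size `m′` comes with an equation because `m + k * j + k` and `m + k * suc j`
    -- agree only propositionally.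
    rounds : ∀ {m} (c : V → Fin m) → IsProper G c → ∀ j →
      ∃[ m′ ] (m′ ≡ m + k * j × ∃[ c′ ] (IsProper G {m′} c′ ×
        (2 * Δ) ^ j * #bad c′ ≤ (2 * Δ ∸ δ) ^ j * #bad c))
    rounds {m} c proper zero = m , sym (trans (cong (m +_) (*-zeroʳ k)) (+-identityʳ m)) , c , proper , ≤-refl
    rounds {m} c proper (suc j) with rounds c proper j
    ... | m′ , m′≡ , c′ , proper′ , le with one-round c′ proper′
    ... | c″ , proper″ , le′ = m′ + k , trans (cong (_+ k) m′≡) (colours m k j) , c″ , proper″ , (begin
      p * p ^ j * #bad c″         ≡⟨ xy∙z≈y∙xz p (p ^ j) (#bad c″) ⟩
      p ^ j * (p * #bad c″)       ≤⟨ *-monoʳ-≤ (p ^ j) le′ ⟩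
      p ^ j * (q * #bad c′)       ≡⟨ xy∙z≈y∙xz q (p ^ j) (#bad c′) ⟨
      q * p ^ j * #bad c′         ≡⟨ *-assoc q (p ^ j) (#bad c′) ⟩
      q * (p ^ j * #bad c′)       ≤⟨ *-monoʳ-≤ q le ⟩
      q * (q ^ j * #bad c)        ≡⟨ *-assoc q (q ^ j) (#bad c) ⟨
      q * q ^ j * #bad c          ∎)
      where
      p = 2 * Δ
      q = 2 * Δ ∸ δ
      colours : ∀ m k j → m + k * j + k ≡ m + k * (1 + j)
      colours = solve-∀

  -- Bounding the initial number of bad vertices.

  -- Two adjacent vertices cannot both be strict local minima of `c`, nor both strict local maxima,
  -- so each kind forms an independent set.
  #bad≤2α : ∀ {m α} (c : V → Fin m) → IsProper G c → (∀ v → 1 ≤ deg G v) →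
    (∀ S → IsIndependent G S → ∣ S ∣ ≤ α) → #bad c ≤ α + α
  #bad≤2α {α = α} c proper 1≤deg ≤α = begin
    #bad c                                                 ≤⟨ ∑-mono _ _ pointwise ⟩
    sum (λ v → 𝟙 (min? v) + 𝟙 (max? v))                   ≡⟨ ∑-distrib-+ (λ v → 𝟙 (min? v)) (λ v → 𝟙 (max? v)) ⟩
    sum (λ v → 𝟙 (min? v)) + sum (λ v → 𝟙 (max? v))       ≡⟨ cong₂ _+_ (∣⟪⟫∣ min?) (∣⟪⟫∣ max?) ⟨
    ∣ ⟪ min? ⟫ ∣ + ∣ ⟪ max? ⟫ ∣                            ≤⟨ +-mono-≤ (≤α _ min-ind) (≤α _ max-ind) ⟩
    α + α                                                  ∎
    where
    open ≤-Reasoning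
    Min Max : V → Set
    Min v = ∀ u → Adj G v u ≡ true → c v Fin.< c u
    Max v = ∀ u → Adj G v u ≡ true → c u Fin.< c v
    min? : ∀ v → Dec (Min v)
    min? v = all? λ u → adj? G v u →-dec c v Fin.<? c u
    max? : ∀ v → Dec (Max v)
    max? v = all? λ u → adj? G v u →-dec c u Fin.<? c v
    min-ind : IsIndependent G ⟪ min? ⟫
    min-ind u v u∈ v∈ = ¬adj G λ uv →
      <-asym (∈⟪⟫⁻ min? u∈ v uv) (∈⟪⟫⁻ min? v∈ u (Adj-symmetric G uv))
    max-ind : IsIndependent G ⟪ max? ⟫
    max-ind u v u∈ v∈ = ¬adj G λ uv →
      <-asym (∈⟪⟫⁻ max? u∈ v uv) (∈⟪⟫⁻ max? v∈ u (Adj-symmetric G uv))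
    has-neighbour : ∀ v → ∃[ u ] Adj G v u ≡ true
    has-neighbour v with nbrs v | length-nbrs v | all-nbrs v
    ... | []    | eq | _      = contradiction (subst (1 ≤_) (sym eq) (1≤deg v)) λ ()
    ... | u ∷ _ | _  | vu ∷ _ = u , vu
    -- All neighbours of `v` share one colour, which differs from that of `v` by properness, so
    -- comparing with a single neighbour decides the case.
    extremal : ∀ v → ¬ SeesTwo c v → Min v ⊎ Max v
    extremal v ¬seen with has-neighbour v
    ... | u , vu with Fin.<-cmp (c v) (c u)
    ... | tri< lt _ _ = inj₁ λ w vw → subst (c v Fin.<_) (bad-constant c ¬seen vu vw) lt
    ... | tri≈ _ eq _ = contradiction eq (proper v u vu)
    ... | tri> _ _ gt = inj₂ λ w vw → subst (Fin._< c v) (bad-constant c ¬seen vu vw) gt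
    pointwise : ∀ v → 𝟙 (¬? (seesTwo? c v)) ≤ 𝟙 (min? v) + 𝟙 (max? v)
    pointwise v with seesTwo? c v
    ... | yes _ = z≤n
    ... | no ¬seen with extremal v ¬seen
    ...   | inj₁ min = ≤-trans (≤-reflexive (sym (𝟙-yes (min? v) min))) (m≤m+n _ _)
    ...   | inj₂ max = ≤-trans (≤-reflexive (sym (𝟙-yes (max? v) max))) (m≤n+m _ _)

  -- The last repair and the resulting dynamic colouring.

  recolour-dynamic : ∀ {m k} (c : V → Fin m) (f : V → Fin k) (I : Subset (order G)) →
    IsProper G c → IsIndependent G I → (∀ v → (∀ u → Adj G v u ≡ true → u ∈ I) → SeesTwo f v) →
    (∀ v → ¬ SeesTwo c v → Hit G I v) → DynColorable G (m + k)
  recolour-dynamic c f I proper ind inner cover =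
    recolour c f I , recolour-proper c f I proper ind , λ v _ → recolour-seesTwo c f I inner v (hit⊎seen v)
    where
    hit⊎seen : ∀ v → Hit G I v ⊎ SeesTwo c v
    hit⊎seen v with seesTwo? c v
    ... | yes seen  = inj₂ seen
    ... | no  ¬seen = inj₁ (cover v ¬seen)

  -- A neighbour `x` of the only bad vertex receives the new colour. Since degrees are at least 2,
  -- no neighbourhood lies inside the recoloured set of at most one vertex, so the condition on
  -- vertices with all neighbours recoloured holds vacuously.
  repair-last : ∀ {m} (c : V → Fin m) → IsProper G c → (∀ v → 2 ≤ deg G v) → #bad c ≤ 1 →
                DynColorable G (m + 1)
  repair-last {m} c proper 2≤deg ≤1 with any? (λ v → ¬? (seesTwo? c v))
  -- With no bad vertex left, the empty set is recoloured; this only enlarges the palette to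
  -- `m + 1`.
  ... | no all-seen = recolour-dynamic c (λ _ → zero) ⊥ proper
      (λ _ _ u∈⊥ → contradiction u∈⊥ ∉⊥)
      (λ v all-in → let u , vu , _ = neighbour-avoiding v (2≤deg v) v in contradiction (all-in u vu) ∉⊥)
      (λ v ¬seen → contradiction (v , ¬seen) all-seen)
  ... | yes (v , ¬seen) = recolour-dynamic c (λ _ → zero) ⁅ x ⁆ proper x-ind
      (λ w all-in → let y , wy , y≢x = neighbour-avoiding w (2≤deg w) x in
        contradiction (x∈⁅y⁆⇒x≡y x (all-in y wy)) y≢x)
      (λ w ¬seen′ → x , subst (λ w → Adj G w x ≡ true) (only w ¬seen′) vx , x∈⁅x⁆ x)
    where
    x : V
    x = proj₁ (neighbour-avoiding v (2≤deg v) v)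
    vx : Adj G v x ≡ true
    vx = proj₁ (proj₂ (neighbour-avoiding v (2≤deg v) v))
    x-ind : IsIndependent G ⁅ x ⁆
    x-ind u w u∈ w∈ rewrite x∈⁅y⁆⇒x≡y x u∈ | x∈⁅y⁆⇒x≡y x w∈ = irrefl G x
    only : ∀ w → ¬ SeesTwo c w → v ≡ w
    only w ¬seen′ = decidable-stable (v ≟ w) λ v≢w → contradiction
      (≤-trans (≤-reflexive (sym (cong₂ _+_ (𝟙-yes (¬? (seesTwo? c v)) ¬seen) (𝟙-yes (¬? (seesTwo? c w)) ¬seen′))))
        (two-terms≤∑ (λ v → 𝟙 (¬? (seesTwo? c v))) v≢w))
      (<⇒≱ (s≤s ≤1))

  dynamic-colouring : ∀ {δ Δ χ α k L} → (∀ v → 2 ≤ deg G v) →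
    (∀ v → δ ≤ deg G v) → (∀ v → deg G v ≤ Δ) → Colorable G χ →
    (∀ S → IsIndependent G S → ∣ S ∣ ≤ α) → α * (2 * Δ ∸ δ) ^ suc L < (2 * Δ) ^ suc L →
    ∃[ f ] (∀ v → SeesTwo {k} f v) → DynColorable G (χ + k * suc L + 1)
  dynamic-colouring {δ} {Δ} {χ} {α} {k} {L} 2≤deg δ≤ ≤Δ (c , proper) ≤α α< (f , f-sees)
    = finish (rounds δ≤ ≤Δ f f-sees c proper (suc L))
    where
    open ≤-Reasoning
    p = 2 * Δ
    q = 2 * Δ ∸ δ
    lemma : ∀ a b → a * (b + b) ≡ 2 * (b * a)
    lemma = solve-∀
    -- The factor 2 comes from `#bad≤2α`: the upper half of the floor-logarithm condition then gives
    -- only `u < 2`, so one bad vertex may remain.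
    few : ∀ u → p ^ suc L * u ≤ q ^ suc L * #bad c → u ≤ 1
    few u le = s≤s⁻¹ (*-cancelˡ-< (p ^ suc L) u 2 (begin-strict
      p ^ suc L * u              ≤⟨ le ⟩
      q ^ suc L * #bad c         ≤⟨ *-monoʳ-≤ (q ^ suc L) (#bad≤2α c proper (<⇒≤ ∘ 2≤deg) ≤α) ⟩
      q ^ suc L * (α + α)        ≡⟨ lemma (q ^ suc L) α ⟩
      2 * (α * q ^ suc L)        <⟨ *-monoʳ-< 2 α< ⟩
      2 * p ^ suc L              ≡⟨ *-comm 2 (p ^ suc L) ⟩
      p ^ suc L * 2              ∎))
    finish : ∃[ m ] (m ≡ χ + k * suc L × ∃[ c′ ] (IsProper G {m} c′ ×
               p ^ suc L * #bad c′ ≤ q ^ suc L * #bad c)) →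
             DynColorable G (χ + k * suc L + 1)
    finish (_ , refl , c′ , proper′ , le) = repair-last c′ proper′ 2≤deg (few (#bad c′) le)

-- Inserting the root and logarithm bounds.

theorem3 : (G : Graph) (δ Δ χ χ₂ α k L : ℕ) →
    IsMinDegree G δ → IsMaxDegree G Δ → 2 ≤ δ →
    IsChromaticNumber G χ → IsDynChromaticNumber G χ₂ →
    IsIndependenceNumber G α →
    IsCeilRoot (δ ∸ 1) (4 * (Δ * Δ)) k →
    IsFloorLog (2 * Δ) (2 * Δ ∸ δ) α L →
    χ₂ ∸ χ ≤ k * (L + 1) + 1
theorem3 G (suc r@(suc _)) Δ χ χ₂ α k L (δ≤ , v₀ , _) (≤Δ , _) 2≤δ@(s≤s (s≤s _)) (χ-col , _) (_ , χ₂-min) (_ , ≤α) (4Δ²≤ , _) (_ , α<) =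
  m≤n+o⇒m∸n≤o χ₂ χ (begin
    χ₂                        ≤⟨ χ₂-min _ (dynamic-colouring G (λ v → ≤-trans 2≤δ (δ≤ v)) δ≤ ≤Δ χ-col ≤α α<
                                   (all-see-two G {{k≢0 k 4Δ²≤}} δ≤ ≤Δ bound)) ⟩
    χ + k * suc L + 1         ≡⟨ +-assoc χ (k * suc L) 1 ⟩
    χ + (k * suc L + 1)       ≡⟨ cong (λ x → χ + (k * x + 1)) (+-comm 1 L) ⟩
    χ + (k * (L + 1) + 1)     ∎)
  where
  open ≤-Reasoning
  δ≤Δ : suc r ≤ Δ
  δ≤Δ = ≤-trans (δ≤ v₀) (≤Δ v₀)
  -- `r` is a successor because `δ` is at least 2, so `0 ^ r` reduces to 0 while `4 * (Δ * Δ)` is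
  -- positive.
  k≢0 : ∀ k → 4 * (Δ * Δ) ≤ k ^ r → NonZero k
  k≢0 zero    4Δ²≤0 = contradiction (≤-trans (*-mono-≤ (s≤s {n = 3} z≤n) (*-mono-≤ 1≤Δ 1≤Δ)) 4Δ²≤0) λ ()
    where
    1≤Δ : 1 ≤ Δ
    1≤Δ = ≤-trans (s≤s z≤n) δ≤Δ
  k≢0 (suc _) _     = _
  rearrange : ∀ a b → a * a * (4 * b) ≡ 4 * (a * a) * b
  rearrange = solve-∀
  -- Here `suc r` is `δ`. In `4 * (Δ * Δ)`, one `Δ` bounds the hypergraph degree, the other the edge
  -- size `δ`, and 4 bounds ((r+1)/r)^r.
  bound : Δ * suc r * suc r ^ r ≤ k ^ r * r ^ r
  bound = begin
    Δ * suc r * suc r ^ r     ≤⟨ *-mono-≤ (*-monoʳ-≤ Δ δ≤Δ) (suc^≤4* r) ⟩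
    Δ * Δ * (4 * r ^ r)       ≡⟨ rearrange Δ (r ^ r) ⟩
    4 * (Δ * Δ) * r ^ r       ≤⟨ *-monoˡ-≤ (r ^ r) 4Δ²≤ ⟩
    k ^ r * r ^ r             ∎
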